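{- Let $k\geq 3$ be an integer and let $G$ be a finite simple $2$-degenerate graph with $\Delta(G)\leq 2k$. Then $\chi'_l(G)\leq k$.
   Context: A graph is $2$-degenerate if every subgraph of it has a vertex of degree at most $2$. A linear forest is a forest each of whose components is a path. A $k$-linear coloring of $G$ is a map $c:E(G)\to\{1,\dots,k\}$ such that each color class forms a linear forest. The linear arboricity $\chi'_l(G)$ is the minimum $k$ such that $G$ has a $k$-linear coloring. $\Delta(G)$ is the maximum degree of $G$. -}

module Defs where

open import Data.Nat using (ℕ; _≤_)
open import Data.Fin using (Fin)
open import Data.Fin.Properties using () renaming (_≟_ to _≟ᶠ_)
open import Data.Bool using (Bool; T; _∧_)
open import Data.Bool.Properties using (T?)
open import Data.List using (List; []; _∷_; length; filter; _∷ʳ_)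
open import Data.List.Relation.Unary.Linked using (Linked)
open import Data.List.Relation.Unary.Unique.Propositional using (Unique)
open import Data.Product using (Σ; _×_; ∃)
open import Data.Empty using (⊥)
open import Relation.Nullary using (¬_)
open import Relation.Nullary.Decidable using (_×-dec_)
open import Relation.Binary.PropositionalEquality using (_≡_)
open import Relation.Unary using (Decidable)
open import Data.List using (allFin)

record Graph (n : ℕ) : Set where
  field
    adj    : Fin n → Fin n → Bool
    sym    : ∀ u v → T (adj u v) → T (adj v u)
    irrefl : ∀ v → ¬ T (adj v v)
open Graph public

degreeB : ∀ {n} → (Fin n → Fin n → Bool) → Fin n → ℕ
degreeB {n} E v = length (filter (λ u → T? (E v u)) (allFin n))

degree : ∀ {n} → Graph n → Fin n → ℕ
degree G v = degreeB (adj G) v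

MaxDegree≤ : ∀ {n} → Graph n → ℕ → Set
MaxDegree≤ G d = ∀ v → degree G v ≤ d

record Subgraph {n : ℕ} (G : Graph n) : Set where
  field
    verts    : Fin n → Bool
    edges    : Fin n → Fin n → Bool
    edge-sym : ∀ u v → T (edges u v) → T (edges v u)
    edge-adj : ∀ u v → T (edges u v) → T (adj G u v)
    edge-src : ∀ u v → T (edges u v) → T (verts u)
    edge-tgt : ∀ u v → T (edges u v) → T (verts v)

TwoDegenerate : ∀ {n} → Graph n → Set
TwoDegenerate {n} G =
  (H : Subgraph G) → ∃ (λ w → T (Subgraph.verts H w)) →
  ∃ (λ v → T (Subgraph.verts H v) × degreeB (Subgraph.edges H) v ≤ 2)

-- A cycle in a (symmetric, irreflexive) relation R: distinct vertices
-- x, y₁, …, y_m (m ≥ 2, i.e. at least 3 vertices) with consecutive ones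
-- related and y_m related to x.
HasCycle : ∀ {n} → (Fin n → Fin n → Set) → Set
HasCycle {n} R =
  Σ (Fin n) λ x → Σ (List (Fin n)) λ ys →
    2 ≤ length ys × Unique (x ∷ ys) × Linked R ((x ∷ ys) ∷ʳ x)

ColourClass : ∀ {n k} → Graph n → (Fin n → Fin n → Fin k) → Fin k →
              Fin n → Fin n → Set
ColourClass G c i u v = T (adj G u v) × c u v ≡ i

colourClass? : ∀ {n k} (G : Graph n) (c : Fin n → Fin n → Fin k) (i : Fin k) →
               (v : Fin n) → Decidable (ColourClass G c i v)
colourClass? G c i v u = T? (adj G v u) ×-dec (c v u ≟ᶠ i)

colourDegree : ∀ {n k} → Graph n → (Fin n → Fin n → Fin k) → Fin k → Fin n → ℕ
colourDegree {n} G c i v = length (filter (colourClass? G c i v) (allFin n))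

-- The colour class i is a linear forest: a forest (no cycles) all of
-- whose components are paths (every vertex has degree ≤ 2).
IsLinearForestClass : ∀ {n k} → Graph n → (Fin n → Fin n → Fin k) → Fin k → Set
IsLinearForestClass G c i =
  (∀ v → colourDegree G c i v ≤ 2) × ¬ HasCycle (ColourClass G c i)

-- A k-linear colouring: an edge colouring with colours Fin k (colour of the
-- edge uv is c u v, required symmetric on edges; values on non-edges are
-- irrelevant) whose colour classes are linear forests.
IsLinearColouring : ∀ {n k} → Graph n → (Fin n → Fin n → Fin k) → Set
IsLinearColouring {n} {k} G c =
  (∀ u v → T (adj G u v) → c u v ≡ c v u) × (∀ i → IsLinearForestClass G c i)

LinearArboricity≤ : ∀ {n} → Graph n → ℕ → Set
LinearArboricity≤ {n} G k = Σ (Fin n → Fin n → Fin k) (IsLinearColouring G)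

{-# OPTIONS --safe #-}

-- Induction on the number of edges. The subgraph induced on the vertices of degree at least 3 has
-- a vertex p of degree at most 2, so all but two neighbours of p have degree at most 2 in G.
-- Let v be such a small neighbour, colour G − pv, and let j be the colour of the other edge at v.
-- If p meets some colour i ≠ j at most once, or misses j, then pv takes that colour. Otherwise
-- p has degree 2k and meets j exactly once. If the j-path leaving p does not end in v, then pv
-- takes j. If it does, then, as 2k > 4, p has a further small neighbour u with c(pu) ≠ j; now pu
-- takes j, which closes no cycle because u, of j-degree at most 1, is not an end of the j-path
-- of p, and pv takes the former colour of pu.
module Submission where

open import Defs
open import Data.Bool using (T; if_then_else_)
open import Data.Bool.Properties using (T?)
open import Data.Empty using (⊥-elim)
open import Data.Fin using (Fin; fromℕ<)
open import Data.Fin.Properties using (any?) renaming (_≟_ to _≟ᶠ_)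
open import Data.List
  using (List; []; _∷_; [_]; _++_; _∷ʳ_; length; map; filter; allFin; cartesianProduct)
open import Data.List.Properties
  using (length-++; filter-notAll; ++-assoc; length-tabulate; length-map)
import Data.List.Relation.Unary.Any as Any
open import Data.List.Relation.Unary.Any using (here; there)
open import Data.List.Relation.Unary.All as All using (All; []; _∷_)
open import Data.List.Relation.Unary.All.Properties using (¬Any⇒All¬; ∷ʳ⁺)
open import Data.List.Relation.Unary.AllPairs using ([]; _∷_)
open import Data.List.Relation.Unary.Linked as Linked using (Linked; []; [-]; _∷_)
open import Data.List.Relation.Unary.Unique.Propositional using (Unique)
import Data.List.Relation.Unary.Unique.Propositional.Properties as Uniqueₚ
open import Data.List.Membership.Propositional using (_∈_; _∉_; lose; find)
open import Data.List.Membership.Propositional.Properties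
  using (∈-∃++; ∈-++⁺ˡ; ∈-++⁺ʳ; ∈-++⁻; ∈-filter⁺; ∈-filter⁻; ∈-allFin; ∈-cartesianProduct⁺)
import Data.List.Membership.DecPropositional as DecMembership
open import Data.Nat using (ℕ; zero; suc; _+_; _*_; _≤_; _<_; _≤?_; z≤n; s≤s)
open import Data.Nat.Properties
open import Data.Nat.Induction using (<-wellFounded)
open import Data.Product using (Σ; ∃; ∃₂; _×_; _,_; proj₁; proj₂)
open import Data.Sum as Sum using (_⊎_; inj₁; inj₂; [_,_]′)
open import Function using (_∘_)
open import Induction.WellFounded using (Acc; acc)
open import Relation.Binary.Construct.Closure.ReflexiveTransitive as Star
  using (Star; ε; _◅_; _◅◅_; reverse)
open import Relation.Binary.PropositionalEquality
  using (_≡_; _≢_; refl; trans; cong; subst; ≢-sym) renaming (sym to ≡-sym)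
open import Relation.Nullary using (¬_; Dec; yes; no; does; contradiction)
open import Relation.Nullary.Decidable
  using (⌊_⌋; dec-true; dec-false; toWitness; fromWitness; ¬?; _×-dec_; _⊎-dec_; decidable-stable)
open import Relation.Unary using (Decidable)

private
  module ∈ᶠ {n : ℕ} = DecMembership (_≟ᶠ_ {n})
open ∈ᶠ using (_∈?_)

-- Counting in lists: pigeonhole and colour multiplicities.

unique⊆⇒length≤ : ∀ {A : Set} {xs ys : List A} → Unique xs →
                  (∀ {x} → x ∈ xs → x ∈ ys) → length xs ≤ length ys
unique⊆⇒length≤ [] _ = z≤n
unique⊆⇒length≤ {xs = x ∷ xs} (x∉xs ∷ u) sub with ∈-∃++ (sub (here refl))
... | as , bs , refl = begin
  suc (length xs)              ≤⟨ s≤s (unique⊆⇒length≤ u sub′) ⟩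
  suc (length (as ++ bs))      ≡⟨ cong suc (length-++ as) ⟩
  suc (length as + length bs)  ≡⟨ +-suc (length as) (length bs) ⟨
  length as + suc (length bs)  ≡⟨ length-++ as ⟨
  length (as ++ x ∷ bs)        ∎
  where
  open ≤-Reasoning
  sub′ : ∀ {y} → y ∈ xs → y ∈ as ++ bs
  sub′ y∈xs with ∈-++⁻ as (sub (there y∈xs))
  ... | inj₁ y∈as         = ∈-++⁺ˡ y∈as
  ... | inj₂ (here refl)  = contradiction refl (All.lookup x∉xs y∈xs)
  ... | inj₂ (there y∈bs) = ∈-++⁺ʳ as y∈bs

-- This is how a neighbour outside a short list of exceptions is found, both for the first small
-- neighbour `v` of `p` and for the later one `u`.
longer⇒∃∉ : ∀ {n} {xs ys : List (Fin n)} → Unique xs → length ys < length xs →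
            ∃ λ x → x ∈ xs × x ∉ ys
longer⇒∃∉ {xs = xs} {ys} u lt with Any.any? (λ x → ¬? (x ∈? ys)) xs
... | yes p = find p
... | no ¬p = contradiction
  (unique⊆⇒length≤ u λ {x} x∈xs → decidable-stable (x ∈? ys) (¬p ∘ lose x∈xs)) (<⇒≱ lt)

length-filter-¬ : ∀ {A : Set} {P : A → Set} (P? : Decidable P) (xs : List A) →
                  length (filter P? xs) + length (filter (¬? ∘ P?) xs) ≡ length xs
length-filter-¬ P? [] = refl
length-filter-¬ P? (x ∷ xs) with P? x
... | yes _ = cong suc (length-filter-¬ P? xs)
... | no  _ = trans (+-suc _ _) (cong suc (length-filter-¬ P? xs))

filter-absorb : ∀ {A : Set} {P Q : A → Set} (P? : Decidable P) (Q? : Decidable Q) →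
                (∀ {x} → Q x → P x) → ∀ xs → filter Q? (filter P? xs) ≡ filter Q? xs
filter-absorb P? Q? Q⇒P [] = refl
filter-absorb P? Q? Q⇒P (x ∷ xs) with P? x
filter-absorb P? Q? Q⇒P (x ∷ xs) | yes _ with Q? x
... | yes _ = cong (x ∷_) (filter-absorb P? Q? Q⇒P xs)
... | no  _ = filter-absorb P? Q? Q⇒P xs
filter-absorb P? Q? Q⇒P (x ∷ xs) | no ¬p with Q? x
... | yes q = contradiction (Q⇒P q) ¬p
... | no  _ = filter-absorb P? Q? Q⇒P xs

count : ∀ {k} → Fin k → List (Fin k) → ℕ
count i xs = length (filter (_≟ᶠ i) xs)

count-map : ∀ {A : Set} {k} (f : A → Fin k) i xs →
            length (filter (λ x → f x ≟ᶠ i) xs) ≡ count i (map f xs)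
count-map f i [] = refl
count-map f i (x ∷ xs) with f x ≟ᶠ i
... | yes _ = cong suc (count-map f i xs)
... | no  _ = count-map f i xs

count-here : ∀ {k} (i : Fin k) xs → count i (i ∷ xs) ≡ suc (count i xs)
count-here i xs with i ≟ᶠ i
... | yes _  = refl
... | no i≢i = contradiction refl i≢i

count-∷ : ∀ {k} (i j : Fin k) xs → count i xs ≤ count i (j ∷ xs)
count-∷ i j xs with j ≟ᶠ i
... | yes _ = n≤1+n _
... | no  _ = ≤-refl

-- The colours are removed one at a time: filtering out `i` takes away at least `d` entries and
-- leaves the multiplicity of every other colour unchanged.
counts≥⇒length≥ : ∀ {k} d (xs : List (Fin k)) → (∀ i → d ≤ count i xs) → d * k ≤ length xs
counts≥⇒length≥ {k} d xs₀ d≤ = subst (λ m → d * m ≤ length xs₀) (length-tabulate {n = k} (λ i → i))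
  (go (allFin k) xs₀ (Uniqueₚ.allFin⁺ k) (λ {i} _ → d≤ i))
  where
  open ≤-Reasoning
  go : ∀ cs xs → Unique cs → (∀ {i} → i ∈ cs → d ≤ count i xs) → d * length cs ≤ length xs
  go [] xs _ _ = subst (_≤ length xs) (≡-sym (*-zeroʳ d)) z≤n
  go (i ∷ cs) xs (i∉cs ∷ u) h = begin
    d * suc (length cs)             ≡⟨ *-suc d (length cs) ⟩
    d + d * length cs               ≤⟨ +-mono-≤ (h (here refl)) (go cs others u h′) ⟩
    count i xs + length others      ≡⟨ length-filter-¬ (_≟ᶠ i) xs ⟩
    length xs                       ∎
    where
    others : List (Fin k)
    others = filter (¬? ∘ (_≟ᶠ i)) xs
    h′ : ∀ {j} → j ∈ cs → d ≤ count j others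
    h′ {j} j∈cs = subst (d ≤_)
      (cong length (≡-sym (filter-absorb (¬? ∘ (_≟ᶠ i)) (_≟ᶠ j)
        (λ { refl refl → All.lookup i∉cs j∈cs refl }) xs)))
      (h (there j∈cs))

-- Predicates with a bounded number of witnesses.

-- The list only covers `P`: it may repeat entries or contain points outside `P`. The same list
-- therefore serves every smaller predicate, with no decidability required.
AtMost : ∀ {A : Set} → ℕ → (A → Set) → Set
AtMost {A} d P = Σ (List A) λ xs → length xs ≤ d × (∀ {u} → P u → u ∈ xs)

module _ {A : Set} {P Q : A → Set} where

  atMost-⊆ : ∀ {d} → (∀ {u} → Q u → P u) → AtMost d P → AtMost d Q
  atMost-⊆ Q⇒P (xs , len , cov) = xs , len , cov ∘ Q⇒P

  atMost-insert : ∀ {d} x → (∀ {u} → Q u → u ≡ x ⊎ P u) → AtMost d P → AtMost (suc d) Q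
  atMost-insert x Q⇒ (xs , len , cov) =
    x ∷ xs , s≤s len , [ here , there ∘ cov ]′ ∘ Q⇒

atMost-∅ : ∀ {A : Set} {d} {P : A → Set} → (∀ {u} → ¬ P u) → AtMost d P
atMost-∅ ¬P = [] , z≤n , ⊥-elim ∘ ¬P

-- The point `x` occurs in the covering list because it satisfies `P`, so filtering it out shortens
-- the list by at least one.
atMost-remove : ∀ {n d x} {P Q : Fin n → Set} → P x → (∀ {u} → Q u → u ≢ x × P u) →
                AtMost (suc d) P → AtMost d Q
atMost-remove {x = x} Px Q⇒ (xs , len , cov) =
  filter (¬? ∘ (_≟ᶠ x)) xs ,
  ≤-pred (≤-trans (filter-notAll (¬? ∘ (_≟ᶠ x)) xs (lose (cov Px) (λ x≢x → x≢x refl))) len) ,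
  λ Qu → ∈-filter⁺ (¬? ∘ (_≟ᶠ x)) (cov (proj₂ (Q⇒ Qu))) (proj₁ (Q⇒ Qu))

atMost-1⇒≡ : ∀ {A : Set} {P : A → Set} {x y} → AtMost 1 P → P x → P y → x ≡ y
atMost-1⇒≡ ([] , _ , cov) Px Py with () ← cov Px
atMost-1⇒≡ (_ ∷ [] , _ , cov) Px Py with here refl ← cov Px | here refl ← cov Py = refl
atMost-1⇒≡ (_ ∷ _ ∷ _ , s≤s () , _) Px Py

atMost-2⇒⊎ : ∀ {n} {P : Fin n → Set} {x y z} → AtMost 2 P →
             P x → P y → P z → x ≢ y → z ≡ x ⊎ z ≡ y
atMost-2⇒⊎ {P = P} {x} {y} {z} am Px Py Pz x≢y with z ≟ᶠ x
... | yes z≡x = inj₁ z≡x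
... | no  z≢x = inj₂ (atMost-1⇒≡ {P = λ u → P u × u ≢ x}
  (atMost-remove Px (λ (Pu , u≢x) → u≢x , Pu) am) (Pz , z≢x) (Py , ≢-sym x≢y))

-- Rotating cycles and inserting an edge into an acyclic relation.

-- The content of `HasCycle` with its base point exposed, so that the base point can be moved around
-- the cycle.
IsCycle : ∀ {n} → (Fin n → Fin n → Set) → Fin n → List (Fin n) → Set
IsCycle R x ys = 2 ≤ length ys × Unique (x ∷ ys) × Linked R ((x ∷ ys) ∷ʳ x)

hasCycle-⊆ : ∀ {n} {R S : Fin n → Fin n → Set} → (∀ {u w} → R u w → S u w) →
             HasCycle R → HasCycle S
hasCycle-⊆ R⊆S (x , ys , len , u , l) = x , ys , len , u , Linked.map R⊆S l

length-∷ʳ : ∀ {A : Set} (xs : List A) y → length (xs ∷ʳ y) ≡ suc (length xs)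
length-∷ʳ xs y = trans (length-++ xs) (+-comm (length xs) 1)

module _ {n : ℕ} {R : Fin n → Fin n → Set} where

  linked-∷ʳ : ∀ xs {x y} → Linked R (xs ∷ʳ x) → R x y → Linked R (xs ∷ʳ x ∷ʳ y)
  linked-∷ʳ [] [-] r = r ∷ [-]
  linked-∷ʳ (_ ∷ []) (s ∷ l) r = s ∷ linked-∷ʳ [] l r
  linked-∷ʳ (_ ∷ xs@(_ ∷ _)) (s ∷ l) r = s ∷ linked-∷ʳ xs l r

  unique-∷ʳ : ∀ {x : Fin n} {xs} → Unique (x ∷ xs) → Unique (xs ∷ʳ x)
  unique-∷ʳ (x∉xs ∷ u) = Uniqueₚ.++⁺ u ([] ∷ [])
    λ { (v∈xs , here refl) → All.lookup x∉xs v∈xs refl }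

  rotate : ∀ {x y ys} → IsCycle R x (y ∷ ys) → IsCycle R y (ys ∷ʳ x)
  rotate {x} {y} {ys} (len , u , r ∷ l) =
    subst (2 ≤_) (≡-sym (length-∷ʳ ys x)) len , unique-∷ʳ u , linked-∷ʳ (y ∷ ys) l r

  rotateTo : ∀ as {x p bs} → IsCycle R x (as ++ p ∷ bs) → ∃ (IsCycle R p)
  rotateTo [] c = _ , rotate c
  rotateTo (a ∷ as) {x} {p} {bs} c =
    rotateTo as (subst (IsCycle R a) (++-assoc as (p ∷ bs) [ x ]) (rotate c))

  cycleThrough : ∀ {x p ys} → p ∈ x ∷ ys → IsCycle R x ys → ∃ (IsCycle R p)
  cycleThrough (here refl) c = _ , c
  cycleThrough (there p∈ys) c with as , _ , refl ← ∈-∃++ p∈ys = rotateTo as c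

module _ {n : ℕ} {R R′ : Fin n → Fin n → Set} {p q : Fin n}
         (R-sym : ∀ {u w} → R u w → R w u) (¬connected : ¬ Star R p q)
         (R′⇒R⊎pq : ∀ {u w} → R′ u w → ((u ≡ p × w ≡ q) ⊎ (u ≡ q × w ≡ p)) ⊎ R u w) where

  private
    avoid : ∀ {u w} → p ≢ u → p ≢ w → R′ u w → R u w
    avoid p≢u p≢w r with R′⇒R⊎pq r
    ... | inj₁ (inj₁ (refl , _)) = contradiction refl p≢u
    ... | inj₁ (inj₂ (_ , refl)) = contradiction refl p≢w
    ... | inj₂ r′                = r′

    linked-avoid : ∀ {xs} → All (p ≢_) xs → Linked R′ xs → Linked R xs
    linked-avoid _                    []      = []
    linked-avoid _                    [-]     = [-]
    linked-avoid (p≢x ∷ p≢y ∷ ps) (r ∷ l) = avoid p≢x p≢y r ∷ linked-avoid (p≢y ∷ ps) l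

    -- The walk returns to p from some z, and only this last step may be the new edge.
    lastStep : ∀ {y} ys → All (p ≢_) (y ∷ ys) → Linked R′ ((y ∷ ys) ∷ʳ p) →
               ∃ λ z → z ∈ y ∷ ys × Star R y z × R′ z p × (R z p → Linked R ((y ∷ ys) ∷ʳ p))
    lastStep []       _                  (r ∷ [-]) = _ , here refl , ε , r , (_∷ [-])
    lastStep (_ ∷ ys) (p≢y ∷ p≢y′ ∷ ps) (r ∷ l)
      with z , z∈ , s , r′ , f ← lastStep ys (p≢y′ ∷ ps) l =
      z , there z∈ , r₀ ◅ s , r′ , λ r″ → r₀ ∷ f r″
      where r₀ = avoid p≢y p≢y′ r

    -- Only the first and the last edge of a cycle based at `p` can be new. If exactly one of them
    -- is, the rest of the cycle connects `p` and `q` in `R`. Both cannot be, since the second and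
    -- the last vertex of the cycle are distinct and would both equal `q`. If neither is, the cycle
    -- already lies in `R`.
    cycleAt-p : ∀ {zs} → IsCycle R′ p zs → HasCycle R
    cycleAt-p {_ ∷ []} (s≤s () , _)
    cycleAt-p {y ∷ y′ ∷ ys} (len , u@((p≢y ∷ p≢y′ ∷ p≢ys) ∷ (y∉ ∷ _)) , r ∷ r′ ∷ l)
      with z , z∈ , s , r″ , f ← lastStep ys (p≢y′ ∷ p≢ys) l
      with R′⇒R⊎pq r | R′⇒R⊎pq r″
    ... | inj₁ (inj₂ (_ , refl)) | _ = contradiction refl p≢y
    ... | _ | inj₁ (inj₁ (refl , _)) = contradiction refl (All.lookup (p≢y′ ∷ p≢ys) z∈)
    ... | inj₁ (inj₁ (_ , refl)) | inj₁ (inj₂ (refl , _)) = contradiction refl (All.lookup y∉ z∈)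
    ... | inj₁ (inj₁ (_ , refl)) | inj₂ z-p =
      contradiction (reverse R-sym (avoid p≢y p≢y′ r′ ◅ s ◅◅ z-p ◅ ε)) ¬connected
    ... | inj₂ p-y | inj₁ (inj₂ (refl , _)) =
      contradiction (p-y ◅ avoid p≢y p≢y′ r′ ◅ s) ¬connected
    ... | inj₂ p-y | inj₂ z-p =
      p , y ∷ y′ ∷ ys , len , u , p-y ∷ avoid p≢y p≢y′ r′ ∷ f z-p

  -- A cycle that misses `p` uses only old edges; any other can be rotated to start at `p`.
  insertEdge-acyclic : ¬ HasCycle R → ¬ HasCycle R′
  insertEdge-acyclic acyclic (x , ys , c@(len , u , l)) with p ∈? (x ∷ ys)
  ... | yes p∈ = acyclic (cycleAt-p (proj₂ (cycleThrough p∈ c)))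
  ... | no p∉ with p≢x ∷ p≢ys ← ¬Any⇒All¬ (x ∷ ys) p∉ =
    acyclic (x , ys , len , u , linked-avoid (p≢x ∷ ∷ʳ⁺ p≢ys p≢x) l)

isolated⇒¬connected : ∀ {n} {R : Fin n → Fin n → Set} {p q} →
                      p ≢ q → (∀ {u} → ¬ R p u) → ¬ Star R p q
isolated⇒¬connected p≢q iso ε       = p≢q refl
isolated⇒¬connected p≢q iso (r ◅ _) = iso r

-- Following a path in a graph of maximum degree 2.

module _ {n : ℕ} {R : Fin n → Fin n → Set}
         (R-sym : ∀ {u w} → R u w → R w u) (R? : ∀ u w → Dec (R u w))
         (deg≤2 : ∀ v → AtMost 2 (R v)) {p : Fin n} (deg-p≤1 : AtMost 1 (R p)) where

  private
    Branching : Fin n → Set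
    Branching v = ∃₂ λ y z → y ≢ z × R v y × R v z

    -- cur ∷ vs is the path walked so far, from its current end back to p.
    walk : ∀ fuel cur vs → n ≤ length vs + fuel → Unique (cur ∷ vs) →
           (∀ {v w} → v ∈ vs → R v w → w ∈ cur ∷ vs) →
           (∀ {v} → v ∈ vs → v ≡ p ⊎ Branching v) →
           cur ≡ p ⊎ (∃ λ z → z ∈ vs × R cur z) →
           p ∈ cur ∷ vs →
           ∃ λ e → ∀ {q} → q ≢ p → q ≢ e → AtMost 1 (R q) → ¬ Star R p q
    -- With no fuel left, `cur ∷ vs` would consist of more than `n` distinct vertices.
    walk zero cur vs n≤ u _ _ _ _ = contradiction
      (≤-trans (unique⊆⇒length≤ u (λ {x} _ → ∈-allFin x)) (≤-reflexive (length-tabulate {n = n} (λ i → i))))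
      (<⇒≱ (s≤s (≤-trans n≤ (≤-reflexive (+-identityʳ _)))))
    walk (suc fuel) cur vs n≤ u closed inner back p∈
      with any? (λ y → R? cur y ×-dec ¬? (y ∈? (cur ∷ vs)))
    ... | yes (y , cur-y , y∉) =
      walk fuel y (cur ∷ vs) (subst (n ≤_) (+-suc (length vs) fuel) n≤)
        (¬Any⇒All¬ _ y∉ ∷ u) closed′ inner′ (inj₂ (cur , here refl , R-sym cur-y)) (there p∈)
      where
      -- The new vertex `y` uses up the last free place at `cur`: either `cur` is `p`, which has at
      -- most one neighbour, or `y` and the predecessor `z` are its only two.
      curNbr : ∀ {w} → R cur w → w ∈ y ∷ cur ∷ vs
      curNbr cur-w = [ (λ cur≡p → here (atMost-1⇒≡ (subst (AtMost 1 ∘ R) (≡-sym cur≡p) deg-p≤1) cur-w cur-y))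
                     , (λ (z , z∈ , cur-z) →
                          [ here , (λ { refl → there (there z∈) }) ]′
                            (atMost-2⇒⊎ (deg≤2 cur) cur-y cur-z cur-w (λ { refl → y∉ (there z∈) })))
                     ]′ back
      closed′ : ∀ {v w} → v ∈ cur ∷ vs → R v w → w ∈ y ∷ cur ∷ vs
      closed′ (here refl) r = curNbr r
      closed′ (there v∈)  r = there (closed v∈ r)
      inner′ : ∀ {v} → v ∈ cur ∷ vs → v ≡ p ⊎ Branching v
      inner′ (there v∈) = inner v∈
      inner′ (here refl) =
        Sum.map₂ (λ (z , z∈ , cur-z) → y , z , (λ { refl → y∉ (there z∈) }) , cur-y , cur-z) back
    ... | no ¬step = cur , unreachable
      where
      closed′ : ∀ {v w} → v ∈ cur ∷ vs → R v w → w ∈ cur ∷ vs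
      closed′ (there v∈)  r = closed v∈ r
      closed′ (here refl) r = decidable-stable (_ ∈? _) (λ w∉ → ¬step (_ , r , w∉))
      star-closed : ∀ {v w} → v ∈ cur ∷ vs → Star R v w → w ∈ cur ∷ vs
      star-closed v∈ ε       = v∈
      star-closed v∈ (r ◅ s) = star-closed (closed′ v∈ r) s
      -- The visited set is closed under `R`, so it contains all that `p` reaches, and each of its
      -- vertices other than `p` and `cur` has two distinct neighbours.
      unreachable : ∀ {q} → q ≢ p → q ≢ cur → AtMost 1 (R q) → ¬ Star R p q
      unreachable q≢p q≢cur deg-q≤1 s with star-closed p∈ s
      ... | here q≡cur = q≢cur q≡cur
      ... | there q∈ with inner q∈
      ...   | inj₁ q≡p = q≢p q≡p
      ...   | inj₂ (_ , _ , y≢z , q-y , q-z) = y≢z (atMost-1⇒≡ deg-q≤1 q-y q-z)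

  -- e is the last vertex of the path that starts at p.
  otherEnd : ∃ λ e → ∀ {q} → q ≢ p → q ≢ e → AtMost 1 (R q) → ¬ Star R p q
  otherEnd = walk n p [] ≤-refl ([] ∷ []) (λ ()) (λ ()) (inj₁ refl) (here refl)

-- Deleting an edge.

Joins : ∀ {n} → Fin n → Fin n → Fin n → Fin n → Set
Joins p v u w = (u ≡ p × w ≡ v) ⊎ (u ≡ v × w ≡ p)

-- Abstract, since otherwise conditions on joins? unfold to Boolean formulas before they can be matched.
abstract
  joins? : ∀ {n} (p v u w : Fin n) → Dec (Joins p v u w)
  joins? p v u w = (u ≟ᶠ p ×-dec w ≟ᶠ v) ⊎-dec (u ≟ᶠ v ×-dec w ≟ᶠ p)

joins-sym : ∀ {n} {p v u w : Fin n} → Joins p v u w → Joins p v w u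
joins-sym (inj₁ (u≡p , w≡v)) = inj₂ (w≡v , u≡p)
joins-sym (inj₂ (u≡v , w≡p)) = inj₁ (w≡p , u≡v)

delete? : ∀ {n} (G : Graph n) (p v u w : Fin n) → Dec (T (adj G u w) × ¬ Joins p v u w)
delete? G p v u w = T? (adj G u w) ×-dec ¬? (joins? p v u w)

delete : ∀ {n} → Graph n → Fin n → Fin n → Graph n
delete G p v = record
  { adj    = λ u w → ⌊ delete? G p v u w ⌋
  ; sym    = λ u w uw → let (a , ¬j) = toWitness uw in
               fromWitness (Graph.sym G u w a , ¬j ∘ joins-sym)
  ; irrefl = λ u uu → irrefl G u (proj₁ (toWitness uu))
  }

module _ {n : ℕ} (G : Graph n) (p v : Fin n) where

  delete⁻ : ∀ {u w} → T (adj (delete G p v) u w) → T (adj G u w) × ¬ Joins p v u w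
  delete⁻ = toWitness

  delete⁺ : ∀ {u w} → T (adj G u w) → ¬ Joins p v u w → T (adj (delete G p v) u w)
  delete⁺ a ¬j = fromWitness (a , ¬j)

neighbours : ∀ {n} → Graph n → Fin n → List (Fin n)
neighbours {n} G v = filter (λ u → T? (adj G v u)) (allFin n)

module _ {n : ℕ} (G : Graph n) where

  ∈-neighbours⁺ : ∀ {v u} → T (adj G v u) → u ∈ neighbours G v
  ∈-neighbours⁺ {v} {u} = ∈-filter⁺ (λ u → T? (adj G v u)) (∈-allFin u)

  ∈-neighbours⁻ : ∀ {v u} → u ∈ neighbours G v → T (adj G v u)
  ∈-neighbours⁻ {v} u∈ = proj₂ (∈-filter⁻ (λ u → T? (adj G v u)) {xs = allFin n} u∈)

  neighbours-unique : ∀ v → Unique (neighbours G v)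
  neighbours-unique v = Uniqueₚ.filter⁺ _ (Uniqueₚ.allFin⁺ n)

  degree≤⇒atMost : ∀ {v d} → degree G v ≤ d → AtMost d (T ∘ adj G v)
  degree≤⇒atMost {v} deg≤ = neighbours G v , deg≤ , ∈-neighbours⁺

delete-degree-< : ∀ {n} (G : Graph n) p v → T (adj G p v) → degree (delete G p v) p < degree G p
delete-degree-< G p v pv = unique⊆⇒length≤
  (¬Any⇒All¬ _ (λ v∈ → proj₂ (delete⁻ G p v (∈-neighbours⁻ (delete G p v) v∈)) (inj₁ (refl , refl)))
    ∷ neighbours-unique (delete G p v) p)
  λ { (here refl) → ∈-neighbours⁺ G pv
    ; (there u∈)  → ∈-neighbours⁺ G (proj₁ (delete⁻ G p v (∈-neighbours⁻ (delete G p v) u∈))) }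

delete-degree-≤ : ∀ {n} (G : Graph n) p v u → degree (delete G p v) u ≤ degree G u
delete-degree-≤ G p v u = unique⊆⇒length≤ (neighbours-unique (delete G p v) u)
  (∈-neighbours⁺ G ∘ proj₁ ∘ delete⁻ G p v ∘ ∈-neighbours⁻ (delete G p v))

delete-twoDegenerate : ∀ {n} (G : Graph n) p v → TwoDegenerate G → TwoDegenerate (delete G p v)
delete-twoDegenerate G p v td H = td record
  { verts    = verts H
  ; edges    = edges H
  ; edge-sym = edge-sym H
  ; edge-adj = λ u w → proj₁ ∘ delete⁻ G p v ∘ edge-adj H u w
  ; edge-src = edge-src H
  ; edge-tgt = edge-tgt H
  }
  where open Subgraph

-- Each edge is listed in both directions, which is harmless for a measure that only has to
-- decrease.
orderedEdges : ∀ {n} → Graph n → List (Fin n × Fin n)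
orderedEdges {n} G =
  filter (λ (u , w) → T? (adj G u w)) (cartesianProduct (allFin n) (allFin n))

-- The list of the smaller graph is a further filtering of the list of `G`, and this filtering drops
-- at least `(p , v)`.
delete-orderedEdges-< : ∀ {n} (G : Graph n) p v → T (adj G p v) →
                        length (orderedEdges (delete G p v)) < length (orderedEdges G)
delete-orderedEdges-< {n} G p v pv = subst (_< length (orderedEdges G))
  (cong length (filter-absorb (λ (u , w) → T? (adj G u w)) del?
    (λ {(u , w)} → proj₁ ∘ delete⁻ G p v {u} {w}) (cartesianProduct (allFin n) (allFin n))))
  (filter-notAll del? (orderedEdges G)
    (lose {x = p , v}
      (∈-filter⁺ (λ (u , w) → T? (adj G u w)) (∈-cartesianProduct⁺ (∈-allFin p) (∈-allFin v)) pv)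
      (λ d → proj₂ (delete⁻ G p v d) (inj₁ (refl , refl)))))
  where
  del? : Decidable (λ ((u , w) : Fin n × Fin n) → T (adj (delete G p v) u w))
  del? (u , w) = T? (adj (delete G p v) u w)

-- Recolouring one edge and adding an edge to a linear colouring.

recolour : ∀ {n k} → (Fin n → Fin n → Fin k) → Fin n → Fin n → Fin k → Fin n → Fin n → Fin k
recolour c p v i u w = if does (joins? p v u w) then i else c u w

module _ {n k : ℕ} (c : Fin n → Fin n → Fin k) (p v : Fin n) (i : Fin k) where

  recolour-joins : ∀ {u w} → Joins p v u w → recolour c p v i u w ≡ i
  recolour-joins {u} {w} j = cong (if_then i else c u w) (dec-true (joins? p v u w) j)

  recolour-¬joins : ∀ {u w} → ¬ Joins p v u w → recolour c p v i u w ≡ c u w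
  recolour-¬joins {u} {w} ¬j = cong (if_then i else c u w) (dec-false (joins? p v u w) ¬j)

  -- Relates the new classes in `G` to the old ones in `delete G p v`; the degree bound and
  -- acyclicity in `addEdge` are both read off from it.
  recolour-class : ∀ (G : Graph n) {t u w} → ColourClass G (recolour c p v i) t u w →
                   (Joins p v u w × t ≡ i) ⊎ ColourClass (delete G p v) c t u w
  recolour-class G {u = u} {w} (uw , ≡t) = byJoins (joins? p v u w)
    where
    byJoins : Dec (Joins p v u w) → _
    byJoins (yes j) = inj₁ (j , trans (≡-sym ≡t) (recolour-joins j))
    byJoins (no ¬j) = inj₂ (delete⁺ G p v uw ¬j , trans (≡-sym (recolour-¬joins ¬j)) ≡t)

record Colours {n k : ℕ} (G : Graph n) (c : Fin n → Fin n → Fin k) : Set where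
  field
    symmetric : ∀ {u w} → T (adj G u w) → c u w ≡ c w u
    degree≤2  : ∀ i v → AtMost 2 (ColourClass G c i v)
    acyclic   : ∀ i → ¬ HasCycle (ColourClass G c i)

  class-sym : ∀ {i u w} → ColourClass G c i u w → ColourClass G c i w u
  class-sym (uw , ≡i) = Graph.sym G _ _ uw , trans (≡-sym (symmetric uw)) ≡i

open Colours

colours⇒linear : ∀ {n k} {G : Graph n} {c : Fin n → Fin n → Fin k} →
                 Colours G c → IsLinearColouring G c
colours⇒linear {n} {G = G} {c} C =
  (λ u w → symmetric C) , λ i → (λ v → bound i v (degree≤2 C i v)) , acyclic C i
  where
  bound : ∀ i v → AtMost 2 (ColourClass G c i v) → colourDegree G c i v ≤ 2
  bound i v (xs , len , cov) = ≤-trans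
    (unique⊆⇒length≤ (Uniqueₚ.filter⁺ (colourClass? G c i v) (Uniqueₚ.allFin⁺ n))
      (λ u∈ → cov (proj₂ (∈-filter⁻ (colourClass? G c i v) {xs = allFin n} u∈))))
    len

delete-colours : ∀ {n k} {G : Graph n} {c : Fin n → Fin n → Fin k} p v →
                 Colours G c → Colours (delete G p v) c
delete-colours {G = G} {c} p v C = record
  { symmetric = symmetric C ∘ proj₁ ∘ delete⁻ G p v
  ; degree≤2  = λ i u → atMost-⊆ class⊆ (degree≤2 C i u)
  ; acyclic   = λ i → acyclic C i ∘ hasCycle-⊆ class⊆
  }
  where
  class⊆ : ∀ {i u w} → ColourClass (delete G p v) c i u w → ColourClass G c i u w
  class⊆ (uw , ≡i) = proj₁ (delete⁻ G p v uw) , ≡i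

-- Only class `i` changes, and only by the edge `pv`: degrees grow at `p` and `v` alone, and a new
-- cycle would need an old `i`-coloured connection between them.
addEdge : ∀ {n k} {G : Graph n} {c : Fin n → Fin n → Fin k} {p v i} → Colours (delete G p v) c →
          AtMost 1 (ColourClass (delete G p v) c i p) → AtMost 1 (ColourClass (delete G p v) c i v) →
          ¬ Star (ColourClass (delete G p v) c i) p v → Colours G (recolour c p v i)
addEdge {G = G} {c} {p} {v} {i} C p≤1 v≤1 ¬connected = record
  { symmetric = symm
  ; degree≤2  = deg
  ; acyclic   = acyc
  }
  where
  c′ = recolour c p v i
  symm : ∀ {u w} → T (adj G u w) → c′ u w ≡ c′ w u
  symm {u} {w} uw = byJoins (joins? p v u w)
    where
    byJoins : Dec (Joins p v u w) → c′ u w ≡ c′ w u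
    byJoins (yes j) = trans (recolour-joins c p v i j) (≡-sym (recolour-joins c p v i (joins-sym j)))
    byJoins (no ¬j) = trans (recolour-¬joins c p v i ¬j)
      (trans (symmetric C (delete⁺ G p v uw ¬j)) (≡-sym (recolour-¬joins c p v i (¬j ∘ joins-sym))))
  deg : ∀ t u → AtMost 2 (ColourClass G c′ t u)
  deg t u with t ≟ᶠ i | u ≟ᶠ p | u ≟ᶠ v
  ... | no t≢i | _ | _ = atMost-⊆
    ([ (λ (_ , t≡i) → contradiction t≡i t≢i) , (λ r → r) ]′ ∘ recolour-class c p v i G) (degree≤2 C t u)
  ... | yes refl | yes refl | _ = atMost-insert v
    (Sum.map₁ [ proj₂ , (λ (p≡v , w≡p) → trans w≡p p≡v) ]′ ∘ Sum.map₁ proj₁ ∘ recolour-class c p v i G) p≤1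
  ... | yes refl | no _ | yes refl = atMost-insert p
    (Sum.map₁ [ (λ (v≡p , w≡v) → trans w≡v v≡p) , proj₂ ]′ ∘ Sum.map₁ proj₁ ∘ recolour-class c p v i G) v≤1
  ... | yes refl | no u≢p | no u≢v = atMost-⊆
    ([ [ (λ (u≡p , _) → contradiction u≡p u≢p) , (λ (u≡v , _) → contradiction u≡v u≢v) ]′ ∘ proj₁ , (λ r → r) ]′
      ∘ recolour-class c p v i G) (degree≤2 C t u)
  acyc : ∀ t → ¬ HasCycle (ColourClass G c′ t)
  acyc t with t ≟ᶠ i
  ... | no t≢i = acyclic C t ∘ hasCycle-⊆
    ([ (λ (_ , t≡i) → contradiction t≡i t≢i) , (λ r → r) ]′ ∘ recolour-class c p v i G)
  ... | yes refl = insertEdge-acyclic (class-sym C) ¬connected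
    (Sum.map₁ proj₁ ∘ recolour-class c p v i G) (acyclic C t)

-- A vertex with at most two neighbours of degree above 2.

record Pivot {n : ℕ} (G : Graph n) : Set where
  field
    p v      : Fin n
    pv       : T (adj G p v)
    v-small  : degree G v ≤ 2
    big      : List (Fin n)
    ∣big∣≤2  : length big ≤ 2
    small    : ∀ {u} → T (adj G p u) → u ∉ big → degree G u ≤ 2

pivot : ∀ {n} {G : Graph n} → TwoDegenerate G → ∃₂ (λ u w → T (adj G u w)) → Pivot G
pivot {n} {G} td (a , b , ab) with any? (λ v → 3 ≤? degree G v)
... | no ¬big = record
  { p = a ; v = b ; pv = ab ; v-small = all-small b ; big = [] ; ∣big∣≤2 = z≤n
  ; small = λ {u} _ _ → all-small u }
  where
  all-small : ∀ u → degree G u ≤ 2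
  all-small u = ≤-pred (≰⇒> (λ 3≤ → ¬big (u , 3≤)))
... | yes (a′ , a′-big) = fromBig (td bigSubgraph (a′ , fromWitness a′-big))
  where
  Big : Fin n → Set
  Big u = 3 ≤ degree G u
  bigEdge? : ∀ u w → Dec (T (adj G u w) × Big u × Big w)
  bigEdge? u w = T? (adj G u w) ×-dec 3 ≤? degree G u ×-dec 3 ≤? degree G w
  bigSubgraph : Subgraph G
  bigSubgraph = record
    { verts    = λ u → ⌊ 3 ≤? degree G u ⌋
    ; edges    = λ u w → ⌊ bigEdge? u w ⌋
    ; edge-sym = λ u w e → let (uw , bu , bw) = toWitness e in
                   fromWitness (Graph.sym G u w uw , bw , bu)
    ; edge-adj = λ _ _ e → proj₁ (toWitness e)
    ; edge-src = λ _ _ e → fromWitness (proj₁ (proj₂ (toWitness e)))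
    ; edge-tgt = λ _ _ e → fromWitness (proj₂ (proj₂ (toWitness e)))
    }
  fromBig : ∃ (λ p → T (Subgraph.verts bigSubgraph p) × degreeB (Subgraph.edges bigSubgraph) p ≤ 2) → Pivot G
  fromBig (p , p-big , few) = record
    { p = p ; v = v ; pv = ∈-neighbours⁻ G v∈ ; v-small = small (∈-neighbours⁻ G v∈) v∉
    ; big = big ; ∣big∣≤2 = few ; small = small }
    where
    -- As `p` itself has degree at least 3, each neighbour of such degree is adjacent to it in
    -- `bigSubgraph`, so these neighbours number at most two.
    big : List (Fin n)
    big = filter (λ u → T? ⌊ bigEdge? p u ⌋) (allFin n)
    small : ∀ {u} → T (adj G p u) → u ∉ big → degree G u ≤ 2
    small {u} pu u∉ = ≤-pred (≰⇒> λ u-big →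
      u∉ (∈-filter⁺ (λ u → T? ⌊ bigEdge? p u ⌋) (∈-allFin u) (fromWitness (pu , toWitness p-big , u-big))))
    -- At least three neighbours against at most two in `big`.
    another = longer⇒∃∉ (neighbours-unique G p) (≤-trans (s≤s few) (toWitness p-big))
    v = proj₁ another
    v∈ = proj₁ (proj₂ another)
    v∉ = proj₂ (proj₂ another)

-- Extending a colouring of `G` without `pv` to `G`.

module _ {n k : ℕ} (3≤k : 3 ≤ k) (G : Graph n) (Δ≤ : MaxDegree≤ G (2 * k)) (P : Pivot G)
         {c : Fin n → Fin n → Fin k} (C : Colours (delete G (Pivot.p P) (Pivot.v P)) c) where

  open Pivot P

  private
    G′ : Graph n
    G′ = delete G p v

    Class : Fin k → Fin n → Fin n → Set
    Class = ColourClass G′ c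

    p≢v : p ≢ v
    p≢v p≡v = irrefl G v (subst (λ u → T (adj G u v)) p≡v pv)

    v≤1 : AtMost 1 (T ∘ adj G′ v)
    v≤1 = atMost-remove {P = T ∘ adj G v} (Graph.sym G p v pv)
      (λ {u} vu → let (a , ¬j) = delete⁻ G p v {v} {u} vu in (λ u≡p → ¬j (inj₂ (refl , u≡p))) , a)
      (degree≤⇒atMost G v-small)

    colourAt-v : ∃ λ j → ∀ {u} → T (adj G′ v u) → c v u ≡ j
    colourAt-v with any? (λ u → T? (adj G′ v u))
    ... | yes (w , vw) = c v w , λ vu → cong (c v) (atMost-1⇒≡ v≤1 vu vw)
    -- If `pv` was the only edge at `v`, any colour can serve as `j`; `3≤k`, read as `2 < k`,
    -- supplies one.
    ... | no none      = fromℕ< 3≤k , λ {u} vu → contradiction (u , vu) none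

    j : Fin k
    j = proj₁ colourAt-v

    isolated-v : ∀ {i u} → i ≢ j → ¬ Class i v u
    isolated-v i≢j (vu , ≡i) = i≢j (trans (≡-sym ≡i) (proj₂ colourAt-v vu))

    coloursAt-p : List (Fin k)
    coloursAt-p = map (c p) (neighbours G′ p)

    classList : Fin k → List (Fin n)
    classList i = filter (λ u → c p u ≟ᶠ i) (neighbours G′ p)

    count⇒length : ∀ {i d} → count i coloursAt-p ≤ d → length (classList i) ≤ d
    count⇒length {i} {d} = subst (_≤ d) (≡-sym (count-map (c p) i (neighbours G′ p)))

    ∈-classList : ∀ {i u} → Class i p u → u ∈ classList i
    ∈-classList {i} (pu , ≡i) = ∈-filter⁺ (λ u → c p u ≟ᶠ i) (∈-neighbours⁺ G′ pu) ≡i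

    count⇒atMost : ∀ {i d} → count i coloursAt-p ≤ d → AtMost d (Class i p)
    count⇒atMost {i} cnt≤ = classList i , count⇒length cnt≤ , ∈-classList

    ¬connected-sym : ∀ {i u w} → ¬ Star (Class i) u w → ¬ Star (Class i) w u
    ¬connected-sym ¬s s = ¬s (reverse (class-sym C) s)

    Extension : Set
    Extension = ∃ λ (c′ : Fin n → Fin n → Fin k) → Colours G c′

    -- The vertex `v` has no edge of colour `i`, so it is isolated in that class and no cycle can
    -- close.
    otherFree : ∀ i → i ≢ j → count i coloursAt-p ≤ 1 → Extension
    otherFree i i≢j cnt≤1 = _ , addEdge {i = i} C (count⇒atMost cnt≤1)
      (atMost-∅ (isolated-v i≢j))
      (¬connected-sym (isolated⇒¬connected (≢-sym p≢v) (isolated-v i≢j)))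

    v-class≤1 : ∀ {i} → AtMost 1 (Class i v)
    v-class≤1 = atMost-⊆ proj₁ v≤1

    -- Now `p` is the isolated end, while `v` may carry one edge of colour `j`.
    jMissing : count j coloursAt-p ≤ 0 → Extension
    jMissing cnt≤0 = _ , addEdge {i = j} C (count⇒atMost (≤-trans cnt≤0 z≤n)) v-class≤1
      (isolated⇒¬connected p≢v (λ r → empty (count⇒atMost cnt≤0) r))
      where
      empty : ∀ {u} {Q : Fin n → Set} → AtMost 0 Q → ¬ Q u
      empty ([] , _ , cov) q with () ← cov q

    -- pu takes the colour j and pv takes the former colour i of pu.
    swap : ∀ {u} → T (adj G p u) → degree G u ≤ 2 → u ≢ v → c p u ≢ j → AtMost 1 (Class j p) →
           ¬ Star (Class j) p u → Extension
    swap {u} pu u-small u≢v i≢j p≤1 ¬connected = _ , addEdge {i = i} C₁ p≤1′ (atMost-∅ isolated-v′)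
      (λ s → isolated⇒¬connected (≢-sym p≢v) isolated-v′ (reverse (class-sym C₁) s))
      where
      i : Fin k
      i = c p u
      p≢u : p ≢ u
      p≢u p≡u = irrefl G u (subst (λ x → T (adj G x u)) p≡u pu)
      pu′ : T (adj G′ p u)
      pu′ = delete⁺ G p v pu [ (λ (_ , u≡v) → u≢v u≡v) , (λ (p≡v , _) → p≢v p≡v) ]′
      c₁ : Fin n → Fin n → Fin k
      c₁ = recolour c p u j
      G″ : Graph n
      G″ = delete G′ p u
      class⊆ : ∀ {t x y} → ColourClass G″ c t x y → Class t x y
      class⊆ (xy , ≡t) = proj₁ (delete⁻ G′ p u xy) , ≡t
      u≤1 : AtMost 1 (T ∘ adj G″ u)
      u≤1 = atMost-remove {P = T ∘ adj G u} (Graph.sym G p u pu)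
        (λ {x} ux → let (a , ¬j) = delete⁻ G′ p u {u} {x} ux in
          (λ x≡p → ¬j (inj₂ (refl , x≡p))) , proj₁ (delete⁻ G p v a))
        (degree≤⇒atMost G u-small)
      C₁ : Colours G′ c₁
      C₁ = addEdge (delete-colours p u C) (atMost-⊆ class⊆ p≤1) (atMost-⊆ proj₁ u≤1)
        (¬connected ∘ Star.map class⊆)
      -- Class `i` has at most two edges at `p` and loses `pu`, which makes room for `pv`.
      p≤1′ : AtMost 1 (ColourClass G′ c₁ i p)
      p≤1′ = atMost-remove {P = Class i p} (pu′ , refl)
        (λ r → [ (λ (_ , i≡j) → contradiction i≡j i≢j)
               , (λ (px , ≡i) → (λ x≡u → proj₂ (delete⁻ G′ p u px) (inj₁ (refl , x≡u))) , class⊆ (px , ≡i)) ]′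
               (recolour-class c p u j G′ r))
        (degree≤2 C i p)
      isolated-v′ : ∀ {x} → ¬ ColourClass G′ c₁ i v x
      isolated-v′ r = [ (λ (_ , i≡j) → i≢j i≡j) , isolated-v i≢j ∘ class⊆ ]′ (recolour-class c p u j G′ r)

    onlyj : (∀ i → i ≢ j → 2 ≤ count i coloursAt-p) → 1 ≤ count j coloursAt-p → Extension
    onlyj others 1≤j = byEnd (v ≟ᶠ e)
      where
      open ≤-Reasoning
      -- One extra `j` brings every colour to multiplicity two, so `p` keeps at least 2k - 1 edges.
      2k≤ : 2 * k ≤ suc (length coloursAt-p)
      2k≤ = counts≥⇒length≥ 2 (j ∷ coloursAt-p) λ i → 2≤ i (i ≟ᶠ j)
        where
        2≤ : ∀ i → Dec (i ≡ j) → 2 ≤ count i (j ∷ coloursAt-p)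
        2≤ i (yes refl) = subst (2 ≤_) (≡-sym (count-here j coloursAt-p)) (s≤s 1≤j)
        2≤ i (no i≢j)   = ≤-trans (others i i≢j) (count-∷ i j coloursAt-p)
      deg′< : length coloursAt-p < degree G p
      deg′< = subst (_< degree G p) (≡-sym (length-map (c p) (neighbours G′ p))) (delete-degree-< G p v pv)
      -- A second `j` would force 2k edges at `p` besides `pv`, exceeding the maximum degree.
      j≤1 : count j coloursAt-p ≤ 1
      j≤1 = ≤-pred (≰⇒> λ 2≤j → <⇒≱ (≤-trans deg′< (Δ≤ p))
        (counts≥⇒length≥ 2 coloursAt-p λ i → 2≤ 2≤j i (i ≟ᶠ j)))
        where
        2≤ : 2 ≤ count j coloursAt-p → ∀ i → Dec (i ≡ j) → 2 ≤ count i coloursAt-p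
        2≤ 2≤j i (yes refl) = 2≤j
        2≤ 2≤j i (no i≢j)   = others i i≢j
      p≤1 : AtMost 1 (Class j p)
      p≤1 = count⇒atMost j≤1
      end = otherEnd (class-sym C) (colourClass? G′ c j) (degree≤2 C j) p≤1
      e = proj₁ end
      forbidden : List (Fin n)
      forbidden = v ∷ big ++ classList j
      few : length forbidden < degree G p
      few = begin-strict
        suc (length (big ++ classList j))        ≡⟨ cong suc (length-++ big) ⟩
        suc (length big + length (classList j))  ≤⟨ s≤s (+-mono-≤ ∣big∣≤2 (count⇒length j≤1)) ⟩
        -- The summands are 1 for `v`, 2 for `big` and 1 for colour `j`; this is where k at least 3
        -- gives enough neighbours.
        4                                        <⟨ s≤s (s≤s (s≤s (s≤s (s≤s z≤n)))) ⟩
        2 * 3                                    ≤⟨ *-monoʳ-≤ 2 3≤k ⟩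
        2 * k                                    ≤⟨ 2k≤ ⟩
        suc (length coloursAt-p)                 ≤⟨ deg′< ⟩
        degree G p                               ∎
      byEnd : Dec (v ≡ e) → Extension
      byEnd (no v≢e) = _ , addEdge {i = j} C p≤1 v-class≤1 (proj₂ end (≢-sym p≢v) v≢e v-class≤1)
      byEnd (yes v≡e) with longer⇒∃∉ (neighbours-unique G p) few
      ... | u , u∈ , u∉ = swap pu u-small u≢v i≢j p≤1 ¬connected
        where
        pu : T (adj G p u)
        pu = ∈-neighbours⁻ G u∈
        u-small : degree G u ≤ 2
        u-small = small pu (u∉ ∘ there ∘ ∈-++⁺ˡ)
        u≢v : u ≢ v
        u≢v = u∉ ∘ here
        u≢p : u ≢ p
        u≢p u≡p = irrefl G p (subst (λ x → T (adj G p x)) u≡p pu)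
        pu′ : T (adj G′ p u)
        pu′ = delete⁺ G p v pu [ (λ (_ , u≡v) → u≢v u≡v) , (λ (p≡v , _) → p≢v p≡v) ]′
        i≢j : c p u ≢ j
        i≢j i≡j = u∉ (there (∈-++⁺ʳ big (∈-classList (pu′ , i≡j))))
        -- Of the at most two edges at `u`, the edge `pu` has a colour different from `j`.
        u≤1 : AtMost 1 (Class j u)
        u≤1 = atMost-remove {P = T ∘ adj G u} (Graph.sym G p u pu)
          (λ {x} (ux , ≡j) →
            (λ { refl → i≢j (trans (symmetric C pu′) ≡j) }) , proj₁ (delete⁻ G p v {u} {x} ux))
          (degree≤⇒atMost G u-small)
        ¬connected : ¬ Star (Class j) p u
        -- The `j`-path from `p` ends in `v`, so `u` is not its end.
        ¬connected = proj₂ end u≢p (λ u≡e → u≢v (trans u≡e (≡-sym v≡e))) u≤1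

  extend : Extension
  extend with any? (λ i → ¬? (i ≟ᶠ j) ×-dec count i coloursAt-p ≤? 1) | count j coloursAt-p ≤? 0
  ... | yes (i , i≢j , cnt≤1) | _         = otherFree i i≢j cnt≤1
  ... | no _                  | yes cnt≤0 = jMissing cnt≤0
  ... | no none               | no cnt≰0  =
    onlyj (λ i i≢j → ≰⇒> λ cnt≤1 → none (i , i≢j , cnt≤1)) (≰⇒> cnt≰0)

-- The induction and the theorem.

colouring : ∀ {n k} → 3 ≤ k → (G : Graph n) → TwoDegenerate G → MaxDegree≤ G (2 * k) →
            Acc _<_ (length (orderedEdges G)) → ∃ λ (c : Fin n → Fin n → Fin k) → Colours G c
colouring 3≤k G td Δ≤ (acc rec) with any? (λ u → any? (λ w → T? (adj G u w)))
... | yes e = extend 3≤k G Δ≤ P (proj₂ smaller)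
  where
  P = pivot td e
  open Pivot P using (p; v; pv)
  smaller = colouring 3≤k (delete G p v) (delete-twoDegenerate G p v td)
    (λ u → ≤-trans (delete-degree-≤ G p v u) (Δ≤ u)) (rec (delete-orderedEdges-< G p v pv))
... | no ¬e = (λ _ _ → fromℕ< 3≤k) , record
  { symmetric = λ _ → refl
  ; degree≤2  = λ i v → atMost-∅ λ (vu , _) → ¬e (_ , _ , vu)
  ; acyclic   = λ { i (_ , _ ∷ _ , _ , _ , (uw , _) ∷ _) → ¬e (_ , _ , uw) }
  }

theorem2 : (k : ℕ) → 3 ≤ k → (n : ℕ) → (G : Graph n) →
    TwoDegenerate G → MaxDegree≤ G (2 * k) → LinearArboricity≤ G k
theorem2 k 3≤k n G td Δ≤ with c , C ← colouring 3≤k G td Δ≤ (<-wellFounded _) =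
  c , colours⇒linear C
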